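{- For $n\ge 1$, let $c_n(\lambda)$ be the characteristic polynomial of the $n\times n$ matrix $C_n$ whose $(p,q)$ entry is $2^{q-p+2}-1$ if $q\ge p-1$ and $0$ if $q<p-1$; and let $c_0(\lambda)=1$. Then for all $n\ge 1$, $$c_{n}(\lambda) = (3-\lambda)c_{n-1}(\lambda) - \sum_{i=2}^{n}(-1)^{i}(2^{i+1}-1)c_{n-i}(\lambda).$$
   Context: The characteristic polynomial of an $n\times n$ matrix $C_n$ is $\det(C_n-\lambda I)$. Empty sums are $0$. -}

module Defs where

open import Level using (0ℓ)
open import Algebra.Bundles.Raw using (RawRing)
import Algebra.Definitions.RawMonoid as RawMonoidDefs
import Algebra.Definitions.RawSemiring as RawSemiringDefs
open import Data.Bool.Base using (if_then_else_)
open import Data.Fin.Base using (Fin; zero; suc; toℕ; punchIn)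
open import Data.Fin.Properties using (_≟_)
open import Data.Integer.Base as ℤ using (ℤ; +_; 0ℤ; 1ℤ)
open import Data.List.Base using (List; []; _∷_; map)
open import Data.Nat.Base as ℕ using (ℕ; zero; suc; _∸_; _≤ᵇ_)
open import Relation.Binary.PropositionalEquality.Core using (_≡_)
open import Relation.Nullary.Decidable.Core using (⌊_⌋)

Matrix : ∀ {a} → Set a → ℕ → Set a
Matrix A n = Fin n → Fin n → A

-- The determinant, by cofactor expansion along the first row.
module Determinant {a ℓ} (R : RawRing a ℓ) where
  open RawRing R
  open RawMonoidDefs +-rawMonoid using (sum)
  open RawSemiringDefs rawSemiring using (_^_)

  minor : ∀ {n} → Matrix Carrier (suc n) → Fin (suc n) → Matrix Carrier n
  minor M j p q = M (suc p) (punchIn j q)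

  det : ∀ {n} → Matrix Carrier n → Carrier
  det {zero}  M = 1#
  det {suc n} M = sum (λ j → (- 1#) ^ toℕ j * (M zero j * det (minor M j)))

-- ℤ[X]: the list a₀ ∷ a₁ ∷ … ∷ [] stands for a₀ + a₁X + ….  Trailing zeros
-- are allowed, so equality of polynomials is _≈_ and not _≡_.
Poly : Set
Poly = List ℤ

coeff : Poly → ℕ → ℤ
coeff []      k       = 0ℤ
coeff (a ∷ f) zero    = a
coeff (a ∷ f) (suc k) = coeff f k

infix  4 _≈_
infixl 6 _+_ _-_
infixl 7 _*_
infix  8 -_

_≈_ : Poly → Poly → Set
f ≈ g = ∀ k → coeff f k ≡ coeff g k

_+_ : Poly → Poly → Poly
[]      + g       = g
(a ∷ f) + []      = a ∷ f
(a ∷ f) + (b ∷ g) = (a ℤ.+ b) ∷ (f + g)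

-_ : Poly → Poly
- f = map (ℤ.-_) f

_-_ : Poly → Poly → Poly
f - g = f + (- g)

_*_ : Poly → Poly → Poly
[]      * g = []
(a ∷ f) * g = map (a ℤ.*_) g + (0ℤ ∷ (f * g))

const : ℤ → Poly
const a = a ∷ []

X : Poly
X = 0ℤ ∷ 1ℤ ∷ []

ℤ[X] : RawRing 0ℓ 0ℓ
ℤ[X] = record
  { Carrier = Poly
  ; _≈_     = _≈_
  ; _+_     = _+_
  ; _*_     = _*_
  ; -_      = -_
  ; 0#      = []
  ; 1#      = const 1ℤ
  }

-- ∑[ a ⋯ b ] f is f a + … + f b, which is 0 when b < a.
∑[_⋯_] : ℕ → ℕ → (ℕ → Poly) → Poly
∑[ a ⋯ b ] f = sum {suc b ∸ a} (λ i → f (a ℕ.+ toℕ i))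
  where open RawMonoidDefs (RawRing.+-rawMonoid ℤ[X]) using (sum)

identity : ∀ {n} → Matrix Poly n
identity p q = if ⌊ p ≟ q ⌋ then const 1ℤ else const 0ℤ

-- det (M − X I)
charPoly : ∀ {n} → Matrix ℤ n → Poly
charPoly M = det (λ p q → const (M p q) - X * identity p q)
  where open Determinant ℤ[X] using (det)

-- Indices start at 0 here; the entries depend only on q − p, so the formula is
-- the same as with indices starting at 1.  When p ≤ q + 1 the truncated
-- subtraction (q + 2) ∸ p is the exact value of q − p + 2.
C : ∀ n → Matrix ℤ n
C n p q =
  if toℕ p ≤ᵇ suc (toℕ q)
  then + (2 ℕ.^ ((toℕ q ℕ.+ 2) ∸ toℕ p)) ℤ.- 1ℤ
  else 0ℤ

c : ℕ → Poly
c zero    = const 1ℤ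
c (suc n) = charPoly (C (suc n))

{-# OPTIONS --safe #-}
-- C n − X I is a Toeplitz–Hessenberg matrix with ones on the subdiagonal.
-- Expand its determinant along the first row.  For j ≥ 1 the first column of
-- the minor at j is (1, 0, …, 0), and deleting its first row and column leaves
-- the minor at j − 1 of the next smaller matrix of the family.  Hence the
-- minor at j has determinant c (n − 1 − j), and the expansion is the recurrence.
module Submission where

open import Defs
open import Data.Integer.Base as ℤ using (+_; -1ℤ; 1ℤ)
open import Data.Nat.Base as ℕ using (ℕ; _≥_; _∸_)

open import Algebra.Bundles using (Ring)
open import Algebra.Bundles.Raw using (RawRing)
import Algebra.Definitions.RawSemiring as RawSemiringDefs
import Algebra.Properties.AbelianGroup as AbelianGroupProperties
import Algebra.Properties.Monoid.Sum as MonoidSum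
import Algebra.Properties.Ring as RingProperties
open import Data.Fin.Base using (Fin; zero; suc; toℕ; punchIn)
open import Data.Fin.Properties using (_≟_)
open import Data.Integer.Base using (ℤ; 0ℤ)
import Data.Integer.Properties as ℤ
open import Data.Integer.Tactic.RingSolver using (solve-∀)
open import Data.List.Base using ([]; _∷_; map)
open import Data.Nat.Base using (zero; suc)
import Data.Nat.Properties as ℕ
open import Data.Product.Base using (_,_)
open import Level using (0ℓ)
open import Relation.Binary.PropositionalEquality.Core as ≡ using (_≡_; refl; cong; cong₂)
import Relation.Binary.Reasoning.Setoid as SetoidReasoning
open import Relation.Nullary.Decidable.Core using (yes; no)

-- Determinants of Toeplitz-Hessenberg matrices over a ring.

module HessenbergDeterminant {a ℓ} (R : Ring a ℓ) where
  open Ring R hiding (zero)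
    renaming (_+_ to _⊕_; _*_ to _⊛_; -_ to ⊝_; _-_ to _⊖_; _≈_ to _≋_; refl to ≋-refl)
  open Determinant rawRing
  open RawSemiringDefs (RawRing.rawSemiring rawRing) using (_^_)
  open MonoidSum +-monoid using (sum; sum-cong-≋; sum-replicate-zero)
  open AbelianGroupProperties +-abelianGroup using (⁻¹-∙-comm; ε⁻¹≈ε)
  open RingProperties R using (-1*x≈-x)
  open SetoidReasoning setoid

  det-cong : ∀ {n} {M N : Matrix Carrier n} → (∀ p q → M p q ≋ N p q) → det M ≋ det N
  det-cong {zero}  M≋N = ≋-refl
  det-cong {suc n} M≋N = sum-cong-≋ λ j →
    *-congˡ {(⊝ 1#) ^ toℕ j} (*-cong (M≋N zero j) (det-cong λ p q → M≋N (suc p) (punchIn j q)))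

  sum-zero : ∀ {n} {f : Fin n → Carrier} → (∀ i → f i ≋ 0#) → sum f ≋ 0#
  sum-zero {n} f≋0 = trans (sum-cong-≋ f≋0) (sum-replicate-zero n)

  sum-neg : ∀ {n} (f : Fin n → Carrier) → sum (λ i → ⊝ f i) ≋ ⊝ sum f
  sum-neg {zero}  f = sym ε⁻¹≈ε
  sum-neg {suc n} f = trans (+-congˡ (sum-neg (λ i → f (suc i)))) (⁻¹-∙-comm _ _)

  -- By induction on the size: the cofactor at 0 has a factor from the zero column, and every other
  -- minor keeps column 0, without its top entry, as its own first column.
  det-column-zero : ∀ {n} (M : Matrix Carrier (suc n)) → (∀ p → M p zero ≋ 0#) → det M ≋ 0#
  det-column-zero M M₀≋0 = sum-zero λ j → trans (*-congˡ {(⊝ 1#) ^ toℕ j} (cofactor j)) (zeroʳ _)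
    where
    cofactor : ∀ j → M zero j ⊛ det (minor M j) ≋ 0#
    cofactor zero            = trans (*-congʳ (M₀≋0 zero)) (zeroˡ _)
    -- The two remaining cases argue alike; splitting the index shows that the minor has positive
    -- size and hence a first column.
    cofactor (suc zero)      =
      trans (*-congˡ (det-column-zero (minor M (suc zero)) λ p → M₀≋0 (suc p))) (zeroʳ _)
    cofactor (suc j@(suc _)) =
      trans (*-congˡ (det-column-zero (minor M (suc j)) λ p → M₀≋0 (suc p))) (zeroʳ _)

  -- Every minor taken at a column other than 0 retains column 0 but loses row 0, where the only
  -- nonzero entry stood; `det-column-zero` kills it. Only the term at 0 survives.
  det-column-unit : ∀ {n} (M : Matrix Carrier (suc n)) →
    M zero zero ≋ 1# → (∀ p → M (suc p) zero ≋ 0#) → det M ≋ det (minor M zero)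
  det-column-unit {n} M M₀₀≋1 M₀≋0 = begin
    1# ⊛ (M zero zero ⊛ det (minor M zero)) ⊕ sum rest ≈⟨ +-congˡ (sum-zero (rest≋0 M M₀≋0)) ⟩
    1# ⊛ (M zero zero ⊛ det (minor M zero)) ⊕ 0#       ≈⟨ +-identityʳ _ ⟩
    1# ⊛ (M zero zero ⊛ det (minor M zero))            ≈⟨ *-identityˡ _ ⟩
    M zero zero ⊛ det (minor M zero)                   ≈⟨ *-congʳ M₀₀≋1 ⟩
    1# ⊛ det (minor M zero)                            ≈⟨ *-identityˡ _ ⟩
    det (minor M zero)                                 ∎
    where
    rest : Fin n → Carrier
    rest j = (⊝ 1#) ^ suc (toℕ j) ⊛ (M zero (suc j) ⊛ det (minor M (suc j)))

    rest≋0 : ∀ {n} (M : Matrix Carrier (suc n)) → (∀ p → M (suc p) zero ≋ 0#) → ∀ j →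
      (⊝ 1#) ^ suc (toℕ j) ⊛ (M zero (suc j) ⊛ det (minor M (suc j))) ≋ 0#
    rest≋0 {suc n} M M₀≋0 j = begin
      _ ⊛ (_ ⊛ det (minor M (suc j))) ≈⟨ *-congˡ (*-congˡ (det-column-zero (minor M (suc j)) M₀≋0)) ⟩
      _ ⊛ (_ ⊛ 0#)                    ≈⟨ *-congˡ (zeroʳ _) ⟩
      _ ⊛ 0#                          ≈⟨ zeroʳ _ ⟩
      0#                              ∎

  module _ (t : ℕ → Carrier) where

    -- Stripping `suc` from both indices makes the matrix Toeplitz by computation: deleting row 0
    -- and column 0 yields the next smaller matrix definitionally.
    entry : ℕ → ℕ → Carrier
    entry zero          q       = t q
    entry (suc p)       (suc q) = entry p q
    entry (suc zero)    zero    = 1#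
    entry (suc (suc p)) zero    = 0#

    hessenberg : ∀ n → Matrix Carrier n
    hessenberg n p q = entry (toℕ p) (toℕ q)

    det-minor-hessenberg : ∀ n (j : Fin (suc n)) →
      det (minor (hessenberg (suc n)) j) ≋ det (hessenberg (n ∸ toℕ j))
    det-minor-hessenberg n       zero    = ≋-refl
    det-minor-hessenberg (suc n) (suc j) = trans
      -- Column 0 of this minor computes to the subdiagonal `1#` followed by zeros, and its minor at
      -- 0 is definitionally `minor (hessenberg (suc n)) j`.
      (det-column-unit (minor (hessenberg (suc (suc n))) (suc j)) ≋-refl (λ p → ≋-refl))
      (det-minor-hessenberg n j)

    -- The first-row term at column `suc i` carries the sign with exponent `suc i`. Pulling one
    -- factor `⊝ 1#` out of each such term produces the subtracted sum and leaves exponent `i`.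
    det-hessenberg : ∀ n →
      det (hessenberg (suc n)) ≋
      t 0 ⊛ det (hessenberg n) ⊖
      sum {n} (λ i → (⊝ 1#) ^ toℕ i ⊛ (t (suc (toℕ i)) ⊛ det (hessenberg (n ∸ suc (toℕ i)))))
    det-hessenberg n = +-cong (*-identityˡ _) (trans (sum-cong-≋ term) (sum-neg f))
      where
      f : Fin n → Carrier
      f i = (⊝ 1#) ^ toℕ i ⊛ (t (suc (toℕ i)) ⊛ det (hessenberg (n ∸ suc (toℕ i))))

      term : ∀ (i : Fin n) →
        (⊝ 1#) ^ suc (toℕ i) ⊛ (t (suc (toℕ i)) ⊛ det (minor (hessenberg (suc n)) (suc i))) ≋
        ⊝ f i
      term i = begin
        (⊝ 1# ⊛ (⊝ 1#) ^ toℕ i) ⊛ _ ≈⟨ *-assoc _ _ _ ⟩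
        ⊝ 1# ⊛ ((⊝ 1#) ^ toℕ i ⊛ _) ≈⟨ -1*x≈-x _ ⟩
        ⊝ ((⊝ 1#) ^ toℕ i ⊛ _)      ≈⟨ -‿cong (*-congˡ (*-congˡ (det-minor-hessenberg n (suc i)))) ⟩
        ⊝ f i                       ∎

-- The ring ℤ[X]

coeff-+ : ∀ f g k → coeff (f + g) k ≡ coeff f k ℤ.+ coeff g k
coeff-+ []      g       k       = ≡.sym (ℤ.+-identityˡ _)
coeff-+ (a ∷ f) []      k       = ≡.sym (ℤ.+-identityʳ _)
coeff-+ (a ∷ f) (b ∷ g) zero    = refl
coeff-+ (a ∷ f) (b ∷ g) (suc k) = coeff-+ f g k

coeff-neg : ∀ f k → coeff (- f) k ≡ ℤ.- coeff f k
coeff-neg []      k       = refl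
coeff-neg (a ∷ f) zero    = refl
coeff-neg (a ∷ f) (suc k) = coeff-neg f k

coeff-scale : ∀ a f k → coeff (map (a ℤ.*_) f) k ≡ a ℤ.* coeff f k
coeff-scale a []      k       = ≡.sym (ℤ.*-zeroʳ a)
coeff-scale a (b ∷ f) zero    = refl
coeff-scale a (b ∷ f) (suc k) = coeff-scale a f k

-- Together with `coeff-*-suc`, this is the coefficient form of (a + X f) g = a g + X (f g). Product
-- laws then become integer identities, by induction on the left factor.
coeff-*-zero : ∀ a f g → coeff ((a ∷ f) * g) 0 ≡ a ℤ.* coeff g 0
coeff-*-zero a f g = ≡.trans (coeff-+ (map (a ℤ.*_) g) (0ℤ ∷ f * g) 0)
  (≡.trans (ℤ.+-identityʳ _) (coeff-scale a g 0))

coeff-*-suc : ∀ a f g k →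
  coeff ((a ∷ f) * g) (suc k) ≡ a ℤ.* coeff g (suc k) ℤ.+ coeff (f * g) k
coeff-*-suc a f g k = ≡.trans (coeff-+ (map (a ℤ.*_) g) (0ℤ ∷ f * g) (suc k))
  (cong (ℤ._+ coeff (f * g) k) (coeff-scale a g (suc k)))

+-cong : ∀ f f′ g g′ → f ≈ f′ → g ≈ g′ → f + g ≈ f′ + g′
+-cong f f′ g g′ f≈f′ g≈g′ k rewrite coeff-+ f g k | coeff-+ f′ g′ k =
  cong₂ ℤ._+_ (f≈f′ k) (g≈g′ k)

+-assoc : ∀ f g h → (f + g) + h ≈ f + (g + h)
+-assoc f g h k
  rewrite coeff-+ (f + g) h k | coeff-+ f g k | coeff-+ f (g + h) k | coeff-+ g h k =
  ℤ.+-assoc (coeff f k) (coeff g k) (coeff h k)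

+-comm : ∀ f g → f + g ≈ g + f
+-comm f g k rewrite coeff-+ f g k | coeff-+ g f k = ℤ.+-comm (coeff f k) (coeff g k)

+-identityʳ : ∀ f → f + [] ≈ f
+-identityʳ f k = ≡.trans (coeff-+ f [] k) (ℤ.+-identityʳ _)

-‿cong : ∀ f g → f ≈ g → - f ≈ - g
-‿cong f g f≈g k rewrite coeff-neg f k | coeff-neg g k = cong ℤ.-_ (f≈g k)

-‿inverseˡ : ∀ f → - f + f ≈ []
-‿inverseˡ f k rewrite coeff-+ (- f) f k | coeff-neg f k = ℤ.+-inverseˡ (coeff f k)

-‿inverseʳ : ∀ f → f - f ≈ []
-‿inverseʳ f k rewrite coeff-+ f (- f) k | coeff-neg f k = ℤ.+-inverseʳ (coeff f k)

-- The hypothesis is `f ≈ []` because a list of zeros also represents 0. This handles equal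
-- polynomials given by lists of different lengths in `*-congʳ`.
*-zeroˡ : ∀ f g → f ≈ [] → f * g ≈ []
*-zeroˡ []      g f≈0 k = refl
*-zeroˡ (a ∷ f) g f≈0 zero
  rewrite coeff-*-zero a f g | f≈0 0 = refl
*-zeroˡ (a ∷ f) g f≈0 (suc k)
  rewrite coeff-*-suc a f g k | f≈0 0 | *-zeroˡ f g (λ k → f≈0 (suc k)) k = refl

*-congʳ : ∀ f f′ g → f ≈ f′ → f * g ≈ f′ * g
*-congʳ []      f′        g f≈f′ k = ≡.sym (*-zeroˡ f′ g (λ k → ≡.sym (f≈f′ k)) k)
*-congʳ (a ∷ f) []        g f≈f′ k = *-zeroˡ (a ∷ f) g f≈f′ k
*-congʳ (a ∷ f) (a′ ∷ f′) g f≈f′ zero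
  rewrite coeff-*-zero a f g | coeff-*-zero a′ f′ g = cong (ℤ._* coeff g 0) (f≈f′ 0)
*-congʳ (a ∷ f) (a′ ∷ f′) g f≈f′ (suc k)
  rewrite coeff-*-suc a f g k | coeff-*-suc a′ f′ g k =
  cong₂ ℤ._+_ (cong (ℤ._* coeff g (suc k)) (f≈f′ 0)) (*-congʳ f f′ g (λ k → f≈f′ (suc k)) k)

*-congˡ : ∀ f g g′ → g ≈ g′ → f * g ≈ f * g′
*-congˡ []      g g′ g≈g′ k = refl
*-congˡ (a ∷ f) g g′ g≈g′ zero
  rewrite coeff-*-zero a f g | coeff-*-zero a f g′ = cong (a ℤ.*_) (g≈g′ 0)
*-congˡ (a ∷ f) g g′ g≈g′ (suc k)
  rewrite coeff-*-suc a f g k | coeff-*-suc a f g′ k =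
  cong₂ ℤ._+_ (cong (a ℤ.*_) (g≈g′ (suc k))) (*-congˡ f g g′ g≈g′ k)

*-distribˡ-+ : ∀ f g h → f * (g + h) ≈ f * g + f * h
*-distribˡ-+ []      g h k = refl
*-distribˡ-+ (a ∷ f) g h zero
  rewrite coeff-*-zero a f (g + h) | coeff-+ ((a ∷ f) * g) ((a ∷ f) * h) 0
        | coeff-*-zero a f g | coeff-*-zero a f h | coeff-+ g h 0 =
  ℤ.*-distribˡ-+ a (coeff g 0) (coeff h 0)
*-distribˡ-+ (a ∷ f) g h (suc k)
  rewrite coeff-*-suc a f (g + h) k | coeff-+ ((a ∷ f) * g) ((a ∷ f) * h) (suc k)
        | coeff-*-suc a f g k | coeff-*-suc a f h k | coeff-+ g h (suc k)
        | *-distribˡ-+ f g h k | coeff-+ (f * g) (f * h) k =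
  regroup a (coeff g (suc k)) (coeff h (suc k)) (coeff (f * g) k) (coeff (f * h) k)
  where
  regroup : ∀ a x y u v → a ℤ.* (x ℤ.+ y) ℤ.+ (u ℤ.+ v) ≡ (a ℤ.* x ℤ.+ u) ℤ.+ (a ℤ.* y ℤ.+ v)
  regroup = solve-∀

*-distribʳ-+ : ∀ h f g → (f + g) * h ≈ f * h + g * h
*-distribʳ-+ h []      g       k = refl
*-distribʳ-+ h (a ∷ f) []      k = ≡.sym (+-identityʳ ((a ∷ f) * h) k)
*-distribʳ-+ h (a ∷ f) (b ∷ g) zero
  rewrite coeff-*-zero (a ℤ.+ b) (f + g) h | coeff-+ ((a ∷ f) * h) ((b ∷ g) * h) 0
        | coeff-*-zero a f h | coeff-*-zero b g h =
  ℤ.*-distribʳ-+ (coeff h 0) a b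
*-distribʳ-+ h (a ∷ f) (b ∷ g) (suc k)
  rewrite coeff-*-suc (a ℤ.+ b) (f + g) h k | coeff-+ ((a ∷ f) * h) ((b ∷ g) * h) (suc k)
        | coeff-*-suc a f h k | coeff-*-suc b g h k
        | *-distribʳ-+ h f g k | coeff-+ (f * h) (g * h) k =
  regroup a b (coeff h (suc k)) (coeff (f * h) k) (coeff (g * h) k)
  where
  regroup : ∀ a b x u v → (a ℤ.+ b) ℤ.* x ℤ.+ (u ℤ.+ v) ≡ (a ℤ.* x ℤ.+ u) ℤ.+ (b ℤ.* x ℤ.+ v)
  regroup = solve-∀

-- Needed for associativity, where the scaled list `map (a ℤ.*_) g` appears as a left factor.
scale-* : ∀ a f g k → coeff (map (a ℤ.*_) f * g) k ≡ a ℤ.* coeff (f * g) k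
scale-* a []      g k = ≡.sym (ℤ.*-zeroʳ a)
scale-* a (b ∷ f) g zero
  rewrite coeff-*-zero (a ℤ.* b) (map (a ℤ.*_) f) g | coeff-*-zero b f g =
  ℤ.*-assoc a b (coeff g 0)
scale-* a (b ∷ f) g (suc k)
  rewrite coeff-*-suc (a ℤ.* b) (map (a ℤ.*_) f) g k | coeff-*-suc b f g k | scale-* a f g k =
  regroup a b (coeff g (suc k)) (coeff (f * g) k)
  where
  regroup : ∀ a b x u → (a ℤ.* b) ℤ.* x ℤ.+ a ℤ.* u ≡ a ℤ.* (b ℤ.* x ℤ.+ u)
  regroup = solve-∀

-- Distributing `h` over a g + X (f g) leaves two pieces: the scalar moves out by `scale-*`, and the
-- factor X by `shift`.
*-assoc : ∀ f g h → (f * g) * h ≈ f * (g * h)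
*-assoc []      g h k = refl
*-assoc (a ∷ f) g h k
  rewrite *-distribʳ-+ h (map (a ℤ.*_) g) (0ℤ ∷ f * g) k
        | coeff-+ (map (a ℤ.*_) g * h) ((0ℤ ∷ f * g) * h) k
        | coeff-+ (map (a ℤ.*_) (g * h)) (0ℤ ∷ f * (g * h)) k
        | scale-* a g h k | coeff-scale a (g * h) k =
  cong (λ x → a ℤ.* coeff (g * h) k ℤ.+ x) (shift k)
  where
  -- Prefixing `0ℤ` is multiplication by X; the induction hypothesis for `f` enters here, one
  -- coefficient lower.
  shift : (0ℤ ∷ f * g) * h ≈ 0ℤ ∷ f * (g * h)
  shift zero    = coeff-*-zero 0ℤ (f * g) h
  shift (suc k) = ≡.trans (coeff-*-suc 0ℤ (f * g) h k)
    (≡.trans (ℤ.+-identityˡ _) (*-assoc f g h k))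

*-identityˡ : ∀ f → const 1ℤ * f ≈ f
*-identityˡ f zero    = ≡.trans (coeff-*-zero 1ℤ [] f) (ℤ.*-identityˡ _)
*-identityˡ f (suc k) = ≡.trans (coeff-*-suc 1ℤ [] f k)
  (≡.trans (ℤ.+-identityʳ _) (ℤ.*-identityˡ _))

*-identityʳ : ∀ f → f * const 1ℤ ≈ f
*-identityʳ []      k       = refl
*-identityʳ (a ∷ f) zero    = ≡.trans (coeff-*-zero a f (const 1ℤ)) (ℤ.*-identityʳ a)
*-identityʳ (a ∷ f) (suc k) = ≡.trans (coeff-*-suc a f (const 1ℤ) k)
  (≡.trans (cong (ℤ._+ coeff (f * const 1ℤ) k) (ℤ.*-zeroʳ a))
  (≡.trans (ℤ.+-identityˡ _) (*-identityʳ f k)))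

ℤ[X]-ring : Ring 0ℓ 0ℓ
ℤ[X]-ring = record
  { Carrier = Poly
  ; _≈_     = _≈_
  ; _+_     = _+_
  ; _*_     = _*_
  ; -_      = -_
  ; 0#      = []
  ; 1#      = const 1ℤ
  ; isRing  = record
    { +-isAbelianGroup = record
      { isGroup = record
        { isMonoid = record
          { isSemigroup = record
            { isMagma = record
              { isEquivalence = record
                { refl  = λ k → refl
                ; sym   = λ f≈g k → ≡.sym (f≈g k)
                ; trans = λ f≈g g≈h k → ≡.trans (f≈g k) (g≈h k)
                }
              ; ∙-cong = λ {f} {f′} {g} {g′} → +-cong f f′ g g′
              }
            ; assoc = +-assoc
            }
          ; identity = (λ f k → refl) , +-identityʳ
          }
        ; inverse = -‿inverseˡ , -‿inverseʳ
        ; ⁻¹-cong = λ {f} {g} → -‿cong f g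
        }
      ; comm = +-comm
      }
    ; *-cong = λ {f} {f′} {g} {g′} f≈f′ g≈g′ k →
        ≡.trans (*-congʳ f f′ g f≈f′ k) (*-congˡ f′ g g′ g≈g′ k)
    ; *-assoc = *-assoc
    ; *-identity = *-identityˡ , *-identityʳ
    ; distrib = *-distribˡ-+ , *-distribʳ-+
    }
  }

-- Specialisation to ℤ[X]: signs, constants and the characteristic matrix.

open HessenbergDeterminant ℤ[X]-ring
open RawSemiringDefs (RawRing.rawSemiring ℤ[X]) using (_^_)
open Determinant ℤ[X] using (det)
open MonoidSum (Ring.+-monoid ℤ[X]-ring) using (sum; sum-cong-≋)
open SetoidReasoning (Ring.setoid ℤ[X]-ring)

const-* : ∀ a b → const (a ℤ.* b) ≈ const a * const b
const-* a b zero    = ≡.sym (coeff-*-zero a [] (const b))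
const-* a b (suc k) = refl

const-^ : ∀ a i → const (a ℤ.^ i) ≈ const a ^ i
const-^ a zero    = λ k → refl
const-^ a (suc i) = begin
  const (a ℤ.* a ℤ.^ i)     ≈⟨ const-* a (a ℤ.^ i) ⟩
  const a * const (a ℤ.^ i) ≈⟨ *-congˡ (const a) (const (a ℤ.^ i)) (const a ^ i) (const-^ a i) ⟩
  const a * const a ^ i     ∎

-- Absorbs the polynomial sign into the integer coefficient. The exponent grows by 2, which leaves
-- the sign unchanged, because the sum in the recurrence starts at index 2.
const-sign-* : ∀ i a f → const -1ℤ ^ i * (const a * f) ≈ const (-1ℤ ℤ.^ (2 ℕ.+ i) ℤ.* a) * f
const-sign-* i a f = begin
  const -1ℤ ^ i * (const a * f)            ≈⟨ *-assoc (const -1ℤ ^ i) (const a) f ⟨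
  const -1ℤ ^ i * const a * f              ≈⟨ *-congʳ (const -1ℤ ^ i * const a) (const (-1ℤ ℤ.^ i) * const a) f
                                                (*-congʳ (const -1ℤ ^ i) (const (-1ℤ ℤ.^ i)) (const a)
                                                  (λ k → ≡.sym (const-^ -1ℤ i k))) ⟩
  const (-1ℤ ℤ.^ i) * const a * f          ≈⟨ *-congʳ (const (-1ℤ ℤ.^ i ℤ.* a)) (const (-1ℤ ℤ.^ i) * const a) f
                                                (const-* (-1ℤ ℤ.^ i) a) ⟨
  const (-1ℤ ℤ.^ i ℤ.* a) * f              ≡⟨ cong (λ x → const (x ℤ.* a) * f) (negate-twice (-1ℤ ℤ.^ i)) ⟩
  const (-1ℤ ℤ.^ (2 ℕ.+ i) ℤ.* a) * f      ∎
  where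
  negate-twice : ∀ x → x ≡ -1ℤ ℤ.* (-1ℤ ℤ.* x)
  negate-twice = solve-∀

-- The common entry of C - X I on each diagonal, counted upwards from the main one, where 3 is 2² -
-- 1. The exponent is written `2 ℕ.+ i ℕ.+ 1` to match the summand of the recurrence at index 2 + i.
diagonal : ℕ → Poly
diagonal zero    = const (+ 3) - X
diagonal (suc i) = const (+ (2 ℕ.^ (2 ℕ.+ i ℕ.+ 1)) ℤ.- 1ℤ)

C-suc-suc : ∀ {n} (p q : Fin n) → C (suc n) (suc p) (suc q) ≡ C n p q
C-suc-suc zero    q = refl
C-suc-suc (suc p) q = refl

identity-suc-suc : ∀ {n} (p q : Fin n) → identity (suc p) (suc q) ≡ identity p q
identity-suc-suc p q with p ≟ q
... | yes _ = refl
... | no  _ = refl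

-- The first row and column are compared directly, and the rest follows down the diagonals. Since
-- `X * identity p q` is a list of length 2, the coefficients 0, 1 and beyond are separate cases.
charMatrix-hessenberg : ∀ n (p q : Fin n) →
  const (C n p q) - X * identity p q ≈ hessenberg diagonal n p q
charMatrix-hessenberg (suc n) zero zero zero          = refl
charMatrix-hessenberg (suc n) zero zero (suc zero)    = refl
charMatrix-hessenberg (suc n) zero zero (suc (suc k)) = refl
-- The exponents `suc (toℕ q) ℕ.+ 2` and `2 ℕ.+ toℕ q ℕ.+ 1` agree only after a rewrite; off the
-- diagonal, `X * identity` subtracts 0.
charMatrix-hessenberg (suc n) zero (suc q) zero
  rewrite ℕ.+-suc (toℕ q) 1 = ℤ.+-identityʳ _
charMatrix-hessenberg (suc n) zero (suc q) (suc zero)    = refl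
charMatrix-hessenberg (suc n) zero (suc q) (suc (suc k)) = refl
charMatrix-hessenberg (suc n) (suc zero) zero zero             = refl
charMatrix-hessenberg (suc n) (suc zero) zero (suc zero)       = refl
charMatrix-hessenberg (suc n) (suc zero) zero (suc (suc k))    = refl
charMatrix-hessenberg (suc n) (suc (suc p)) zero zero          = refl
charMatrix-hessenberg (suc n) (suc (suc p)) zero (suc zero)    = refl
charMatrix-hessenberg (suc n) (suc (suc p)) zero (suc (suc k)) = refl
-- Both sides are unchanged when the two indices drop by 1.
charMatrix-hessenberg (suc n) (suc p) (suc q) k
  rewrite C-suc-suc p q | identity-suc-suc p q = charMatrix-hessenberg n p q k

c-hessenberg : ∀ n → c n ≈ det (hessenberg diagonal n)
c-hessenberg zero    = λ k → refl
c-hessenberg (suc n) = det-cong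
  {M = λ p q → const (C (suc n) p q) - X * identity p q}
  {N = hessenberg diagonal (suc n)}
  (charMatrix-hessenberg (suc n))

corollary5 : (n : ℕ) → n ≥ 1 →
    c n ≈ (const (+ 3) - X) * c (n ∸ 1)
    - ∑[ 2 ⋯ n ] (λ i → const ((-1ℤ ℤ.^ i) ℤ.* (+ (2 ℕ.^ (i ℕ.+ 1)) ℤ.- 1ℤ)) * c (n ∸ i))
corollary5 (suc n) _ = begin
  c (suc n)                         ≈⟨ c-hessenberg (suc n) ⟩
  d (suc n)                         ≈⟨ det-hessenberg diagonal n ⟩
  (const (+ 3) - X) * d n - sum {n} expansion
    ≈⟨ +-cong ((const (+ 3) - X) * d n) ((const (+ 3) - X) * c n) (- sum {n} expansion) (- sum {n} recurrence)
         (*-congˡ (const (+ 3) - X) (d n) (c n) (λ k → ≡.sym (c-hessenberg n k)))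
         (-‿cong (sum {n} expansion) (sum {n} recurrence) (sum-cong-≋ {n} {expansion} {recurrence} term)) ⟩
  (const (+ 3) - X) * c n - sum {n} recurrence ∎
  where
  d : ℕ → Poly
  d m = det (hessenberg diagonal m)

  -- The summation index of the theorem is `2 ℕ.+ toℕ i`. By computation the sum has
  -- `suc (suc n) ∸ 2`, that is `n`, terms, `suc n ∸ (2 ℕ.+ toℕ i)` is `n ∸ suc (toℕ i)`, and
  -- `- const 1ℤ` is `const -1ℤ`.
  expansion recurrence : Fin n → Poly
  expansion i = const -1ℤ ^ toℕ i * (diagonal (suc (toℕ i)) * d (n ∸ suc (toℕ i)))
  recurrence i =
    const (-1ℤ ℤ.^ (2 ℕ.+ toℕ i) ℤ.* (+ (2 ℕ.^ (2 ℕ.+ toℕ i ℕ.+ 1)) ℤ.- 1ℤ)) * c (n ∸ suc (toℕ i))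

  term : ∀ i → expansion i ≈ recurrence i
  term i = begin
    expansion i    ≈⟨ const-sign-* (toℕ i) a (d m) ⟩
    const b * d m  ≈⟨ *-congˡ (const b) (c m) (d m) (c-hessenberg m) ⟨
    recurrence i   ∎
    where
    m = n ∸ suc (toℕ i)
    a = + (2 ℕ.^ (2 ℕ.+ toℕ i ℕ.+ 1)) ℤ.- 1ℤ
    b = -1ℤ ℤ.^ (2 ℕ.+ toℕ i) ℤ.* a
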